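{- Let $k=4$ and $r_1\ge r_2\ge r_3\ge r_4\ge 1$. If $(r_1-1)\ge (r_2-1)+(r_3-1)+(r_4-1)$, then the arithmetic mean component competitive ratio for the 4-objective time series search problem is $$z_f^4=\frac18\left[\sqrt{4r_1+\{(r_2-1)+(r_3-1)+(r_4-1)\}^2}+(r_2+1)+(r_3+1)+(r_4+1)\right].$$
   Context: For an integer $k\ge 2$ and reals $0<m_i\le M_i$ ($1\le i\le k$), let $r_i=M_i/m_i$ be the fluctuation ratio of the price interval $[m_i,M_i]$ of the $i$th objective. It is assumed throughout that $r_1\ge\cdots\ge r_k\ge 1$. The arithmetic mean component competitive ratio of the $k$-objective time series search problem is the quantity $$z_f^k=\sup_{(x_1,\ldots,x_k)\in\mathcal{S}_f^k}\frac1k\left(\frac{M_1}{x_1}+\cdots+\frac{M_k}{x_k}\right),$$ where $$\mathcal{S}_f^k=\left\{(x_1,\ldots,x_k)\in[m_1,M_1]\times\cdots\times[m_k,M_k] : \frac1k\sum_{i=1}^k\frac{x_i}{m_i}=\frac1k\sum_{i=1}^k\frac{M_i}{x_i}\right\}.$$ -}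

module Defs where

open import Level using (_⊔_; suc)
open import Algebra.Apartness.Bundles using (HeytingCommutativeRing; HeytingField)
open import Algebra.Bundles using (CommutativeRing)
import Algebra.Definitions.RawMonoid as RawMonoidDefs
open import Data.Nat.Base as ℕ using (ℕ; NonZero)
open import Data.Product.Base using (Σ; ∃; _×_; _,_; proj₁; proj₂)
open import Data.Sum.Base using (_⊎_; inj₁; inj₂)
open import Data.Empty using (⊥-elim)
open import Data.Vec.Functional using (Vector)
open import Relation.Binary.Core using (Rel)
open import Relation.Binary.Structures using (IsStrictPartialOrder)
open import Relation.Nullary.Negation using (¬_)

-- Ordered fields in constructive form: _#_ is apartness, and the Heyting field
-- structure inverts precisely the elements apart from 0.
record OrderedField c ℓ₁ ℓ₂ : Set (suc (c ⊔ ℓ₁ ⊔ ℓ₂)) where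
  infix 4 _<_ _≤_
  infix 7 _/_⟨_⟩ _/ℕ_
  field
    heytingField : HeytingField c ℓ₁ ℓ₂

  open HeytingField heytingField public
  open CommutativeRing
    (HeytingCommutativeRing.commutativeRing heytingCommutativeRing) public
    using (+-rawMonoid)

  field
    _<_                  : Rel Carrier ℓ₂
    isStrictPartialOrder : IsStrictPartialOrder _≈_ _<_
    #⇒<⊎>                : ∀ {x y} → x # y → x < y ⊎ y < x
    <⇒#                  : ∀ {x y} → x < y → x # y
    0<1                  : 0# < 1#
    +-monoˡ-<            : ∀ z {x y} → x < y → x + z < y + z
    *-pos                : ∀ {x y} → 0# < x → 0# < y → 0# < x * y

  private module < = IsStrictPartialOrder isStrictPartialOrder

  _≤_ : Rel Carrier ℓ₂
  x ≤ y = ¬ (y < x)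

  ι : ℕ → Carrier
  ι n = RawMonoidDefs._×_ +-rawMonoid n 1#

  sum : ∀ {n} → Vector Carrier n → Carrier
  sum = RawMonoidDefs.sum +-rawMonoid

  -- As m and n range independently, the one-sided bound also gives
  -- ∣ s m - s n ∣ < ε.
  IsCauchy : (ℕ → Carrier) → Set (c ⊔ ℓ₂)
  IsCauchy s = ∀ ε → 0# < ε →
    ∃ λ N → ∀ m n → N ℕ.≤ m → N ℕ.≤ n → s m < s n + ε

  _ConvergesTo_ : (ℕ → Carrier) → Carrier → Set (c ⊔ ℓ₂)
  s ConvergesTo l = ∀ ε → 0# < ε →
    ∃ λ N → ∀ n → N ℕ.≤ n → s n < l + ε × l < s n + ε

  <-≤-trans : ∀ {x y z} → x < y → y ≤ z → x < z
  <-≤-trans {x} {y} {z} x<y y≤z with #-cotrans (<⇒# x<y) z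
  ... | inj₁ x#z with #⇒<⊎> x#z
  ...   | inj₁ x<z = x<z
  ...   | inj₂ z<x = ⊥-elim (y≤z (<.trans z<x x<y))
  <-≤-trans {x} {y} {z} x<y y≤z | inj₂ z#y with #⇒<⊎> z#y
  ...   | inj₁ z<y = ⊥-elim (y≤z z<y)
  ...   | inj₂ y<z = <.trans x<y y<z

  0<ι : ∀ n → 0# < ι (ℕ.suc n)
  0<ι ℕ.zero    = <.<-respʳ-≈ (sym (+-identityʳ 1#)) 0<1
  0<ι (ℕ.suc n) = <.trans (0<ι n)
    (<.<-respʳ-≈ refl (<.<-respˡ-≈ (+-identityˡ _) (+-monoˡ-< (ι (ℕ.suc n)) 0<1)))

  -- #⇒invertible yields an inverse of y - 0#, which is an inverse of y.
  _/_⟨_⟩ : ∀ (x y : Carrier) → 0# < y → Carrier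
  x / y ⟨ 0<y ⟩ = x * proj₁ (#⇒invertible (#-sym (<⇒# 0<y)))

  _/ℕ_ : Carrier → (n : ℕ) → .{{NonZero n}} → Carrier
  x /ℕ ℕ.suc n = x / ι (ℕ.suc n) ⟨ 0<ι n ⟩

  -- s = √ a
  IsSqrt : Carrier → Carrier → Set (ℓ₁ ⊔ ℓ₂)
  IsSqrt a s = 0# ≤ s × s * s ≈ a

  IsSupremum : ∀ {p} → (Carrier → Set p) → Carrier → Set (c ⊔ ℓ₂ ⊔ p)
  IsSupremum P z =
    (∀ y → P y → y ≤ z) × (∀ u → (∀ y → P y → y ≤ u) → z ≤ u)

-- The real numbers, given axiomatically as a Cauchy-complete Archimedean
-- ordered field; classically this determines ℝ up to isomorphism.
record Reals c ℓ₁ ℓ₂ : Set (suc (c ⊔ ℓ₁ ⊔ ℓ₂)) where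
  field
    orderedField : OrderedField c ℓ₁ ℓ₂

  open OrderedField orderedField public

  field
    archimedean : ∀ x → ∃ λ n → x < ι n
    complete    : ∀ s → IsCauchy s → ∃ λ l → s ConvergesTo l

module _ {c ℓ₁ ℓ₂} (ℝ : Reals c ℓ₁ ℓ₂) where
  open Reals ℝ

  record PriceIntervals (k : ℕ) : Set (c ⊔ ℓ₂) where
    field
      m M : Vector Carrier k
      0<m : ∀ i → 0# < m i
      m≤M : ∀ i → m i ≤ M i

    fluctuationRatio : Vector Carrier k
    fluctuationRatio i = M i / m i ⟨ 0<m i ⟩

    InBox : Vector Carrier k → Set ℓ₂
    InBox x = ∀ i → m i ≤ x i × x i ≤ M i

    InBox⇒0< : ∀ {x} → InBox x → ∀ i → 0# < x i
    InBox⇒0< x∈ i = <-≤-trans (0<m i) (proj₁ (x∈ i))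

    module _ .{{_ : NonZero k}} where

      meanOfPriceOverMin : Vector Carrier k → Carrier
      meanOfPriceOverMin x = sum (λ i → x i / m i ⟨ 0<m i ⟩) /ℕ k

      meanOfMaxOverPrice : ∀ x → InBox x → Carrier
      meanOfMaxOverPrice x x∈ = sum (λ i → M i / x i ⟨ InBox⇒0< x∈ i ⟩) /ℕ k

      -- (x , x∈) ∈ 𝒮 is the membership of x in the set 𝒮_f^k
      𝒮 : Σ (Vector Carrier k) InBox → Set ℓ₁
      𝒮 (x , x∈) = meanOfPriceOverMin x ≈ meanOfMaxOverPrice x x∈

      -- z = z_f^k
      IsArithmeticMeanComponentCompetitiveRatio : Carrier → Set (c ⊔ ℓ₁ ⊔ ℓ₂)
      IsArithmeticMeanComponentCompetitiveRatio = IsSupremum λ y →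
        ∃ λ p → 𝒮 p × y ≈ meanOfMaxOverPrice (proj₁ p) (proj₂ p)

-- With wᵢ = xᵢ / mᵢ and vᵢ = Mᵢ / xᵢ one has wᵢ vᵢ = rᵢ and wᵢ , vᵢ ≥ 1, so that
-- (wᵢ - 1)(vᵢ - 1) ≥ 0 gives wᵢ + vᵢ ≤ rᵢ + 1, and likewise ∣ vᵢ - wᵢ ∣ ≤ rᵢ - 1.
-- On 𝒮 the sum of the vᵢ is half the sum of the wᵢ + vᵢ, and w₁ - v₁ is the sum of
-- the vᵢ - wᵢ with i ≥ 2, hence at most D in absolute value; therefore
-- (w₁ + v₁)² = 4 r₁ + (w₁ - v₁)² ≤ 4 r₁ + D².  Equality holds throughout when
-- wᵢ = 1 for i ≥ 2 and w₁ - v₁ = D, and D ≤ r₁ - 1 says that this w₁ is at most r₁.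
-- The square root is the limit of Newton's iteration x ↦ (x² + a) / 2x.

module Submission where

open import Defs
open import Data.Fin using (#_)
open import Data.Nat.Base using (nonZero)
open import Data.Product.Base using (∃; _×_)

open import Algebra.Apartness.Bundles using (HeytingCommutativeRing)
open import Algebra.Bundles using (CommutativeRing)
import Algebra.Solver.Ring as RingSolver
open import Algebra.Solver.Ring.AlmostCommutativeRing
  using (fromCommutativeRing; _-Raw-AlmostCommutative⟶_)
open import Data.Empty using (⊥; ⊥-elim)
open import Data.Fin.Base using (zero; suc)
open import Data.Integer.Base as ℤ using (ℤ; +_; -[1+_])
import Data.Integer.Properties as ℤ
open import Data.Maybe.Base using (Maybe; just; nothing)
open import Data.Nat.Base as ℕ using (ℕ; zero; suc)
import Data.Nat.Properties as ℕ
open import Data.Product.Base using (_,_; proj₁; proj₂)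
open import Data.Sum.Base using ([_,_]′)
open import Data.Vec.Functional using (Vector; _∷_; tail)
open import Function.Base using (id)
open import Level using (_⊔_)
open import Relation.Binary.PropositionalEquality.Core as ≡ using ()
import Relation.Binary.Reasoning.Setoid as SetoidReasoning
open import Relation.Binary.Structures using (IsStrictPartialOrder)
open import Relation.Nullary using (yes; no; ¬_)

-- A ring solver with integer coefficients for an arbitrary commutative ring.

module IntegerCoefficients {c ℓ} (R : CommutativeRing c ℓ) where
  open CommutativeRing R
  open import Algebra.Properties.Ring ring
  open import Algebra.Properties.AbelianGroup +-abelianGroup
    using (⁻¹-∙-comm)
  open import Algebra.Properties.CommutativeSemigroup
    (CommutativeRing.+-commutativeSemigroup R) using (interchange)
  open import Algebra.Properties.Semiring.Mult.TCOptimised semiring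
    using (1+×; ×-homo-+; ×1-homo-*) renaming (_×_ to infixl 8 _·_)
  open import Relation.Binary.Reasoning.Setoid setoid

  -- The optimised multiple makes `fromℤ (+ 1)` reduce to `1#` itself, so solver constants match the
  -- literals in goals.
  fromℤ : ℤ → Carrier
  fromℤ (+ n)    = n · 1#
  fromℤ -[1+ n ] = - (suc n · 1#)

  fromℤ-⊖ : ∀ m n → fromℤ (m ℤ.⊖ n) ≈ m · 1# - n · 1#
  fromℤ-⊖ m zero = sym (trans (+-congˡ -0#≈0#) (+-identityʳ _))
  fromℤ-⊖ zero (suc n) = sym (+-identityˡ _)
  fromℤ-⊖ (suc m) (suc n) = begin
    fromℤ (suc m ℤ.⊖ suc n)          ≡⟨ ≡.cong fromℤ (ℤ.[1+m]⊖[1+n]≡m⊖n m n) ⟩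
    fromℤ (m ℤ.⊖ n)                  ≈⟨ fromℤ-⊖ m n ⟩
    -- Inserting `1# - 1#` lets each of the two multiples absorb one unit.
    m · 1# - n · 1#                  ≈⟨ +-identityˡ _ ⟨
    0# + (m · 1# - n · 1#)           ≈⟨ +-congʳ (-‿inverseʳ 1#) ⟨
    (1# - 1#) + (m · 1# - n · 1#)    ≈⟨ interchange _ _ _ _ ⟩
    (1# + m · 1#) + (- 1# - n · 1#)  ≈⟨ +-congˡ (⁻¹-∙-comm _ _) ⟩
    (1# + m · 1#) - (1# + n · 1#)    ≈⟨ +-cong (1+× m 1#) (-‿cong (1+× n 1#)) ⟨
    suc m · 1# - suc n · 1#          ∎

  fromℤ-neg : ∀ i → fromℤ (ℤ.- i) ≈ - fromℤ i
  fromℤ-neg (+ zero)   = sym -0#≈0#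
  fromℤ-neg (+ suc n)  = refl
  fromℤ-neg -[1+ n ]   = sym (-‿involutive _)

  fromℤ-+ : ∀ i j → fromℤ (i ℤ.+ j) ≈ fromℤ i + fromℤ j
  fromℤ-+ (+ m)    (+ n)    = ×-homo-+ 1# m n
  fromℤ-+ (+ m)    -[1+ n ] = fromℤ-⊖ m (suc n)
  fromℤ-+ -[1+ m ] (+ n)    = trans (fromℤ-⊖ n (suc m)) (+-comm _ _)
  fromℤ-+ -[1+ m ] -[1+ n ] = begin
    - (suc (suc (m ℕ.+ n)) · 1#)    ≡⟨ ≡.cong (λ k → - (suc k · 1#)) (≡.sym (ℕ.+-suc m n)) ⟩
    - ((suc m ℕ.+ suc n) · 1#)      ≈⟨ -‿cong (×-homo-+ 1# (suc m) (suc n)) ⟩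
    - (suc m · 1# + suc n · 1#)     ≈⟨ ⁻¹-∙-comm _ _ ⟨
    - (suc m · 1#) - (suc n · 1#)   ∎

  fromℤ-*-pos : ∀ m j → fromℤ (+ m ℤ.* j) ≈ m · 1# * fromℤ j
  fromℤ-*-pos m (+ n) = begin
    fromℤ (+ m ℤ.* + n)   ≡⟨ ≡.cong fromℤ (≡.sym (ℤ.pos-* m n)) ⟩
    (m ℕ.* n) · 1#        ≈⟨ ×1-homo-* m n ⟩
    m · 1# * (n · 1#)     ∎
  fromℤ-*-pos m -[1+ n ] = begin
    fromℤ (+ m ℤ.* -[1+ n ])         ≡⟨ ≡.cong fromℤ (≡.sym (ℤ.neg-distribʳ-* (+ m) (+ suc n))) ⟩
    fromℤ (ℤ.- (+ m ℤ.* + suc n))    ≈⟨ fromℤ-neg (+ m ℤ.* + suc n) ⟩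
    - fromℤ (+ m ℤ.* + suc n)        ≈⟨ -‿cong (fromℤ-*-pos m (+ suc n)) ⟩
    - (m · 1# * (suc n · 1#))        ≈⟨ -‿distribʳ-* _ _ ⟩
    m · 1# * - (suc n · 1#)          ∎

  fromℤ-* : ∀ i j → fromℤ (i ℤ.* j) ≈ fromℤ i * fromℤ j
  fromℤ-* (+ m)    j = fromℤ-*-pos m j
  fromℤ-* -[1+ m ] j = begin
    fromℤ (-[1+ m ] ℤ.* j)           ≡⟨ ≡.cong fromℤ (≡.sym (ℤ.neg-distribˡ-* (+ suc m) j)) ⟩
    fromℤ (ℤ.- (+ suc m ℤ.* j))      ≈⟨ fromℤ-neg (+ suc m ℤ.* j) ⟩
    - fromℤ (+ suc m ℤ.* j)          ≈⟨ -‿cong (fromℤ-*-pos (suc m) j) ⟩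
    - (suc m · 1# * fromℤ j)         ≈⟨ -‿distribˡ-* _ _ ⟩
    - (suc m · 1#) * fromℤ j         ∎

  fromℤ-homo : ℤ.+-*-rawRing -Raw-AlmostCommutative⟶ fromCommutativeRing R
  fromℤ-homo = record
    { ⟦_⟧    = fromℤ
    ; +-homo = fromℤ-+
    ; *-homo = fromℤ-*
    ; -‿homo = fromℤ-neg
    ; 0-homo = refl
    ; 1-homo = refl
    }

  -- Distinct integers can have equal images in positive characteristic, so the negative case gives
  -- no verdict.
  fromℤ-≟ : ∀ i j → Maybe (fromℤ i ≈ fromℤ j)
  fromℤ-≟ i j with i ℤ.≟ j
  ... | yes i≡j = just (reflexive (≡.cong fromℤ i≡j))
  ... | no  _   = nothing

  open RingSolver ℤ.+-*-rawRing (fromCommutativeRing R) fromℤ-homo fromℤ-≟ public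

-- Constructive order arithmetic in an ordered field.

module OrderedFieldProperties {c ℓ₁ ℓ₂} (F : OrderedField c ℓ₁ ℓ₂) where
  open OrderedField F
  private module < = IsStrictPartialOrder isStrictPartialOrder

  open IntegerCoefficients
    (HeytingCommutativeRing.commutativeRing heytingCommutativeRing) public
    using (Polynomial; solve; _:=_; _:+_; _:*_; _:-_; con)
  open SetoidReasoning setoid

  -- ⟦ :ι n ⟧ reduces to ι n.
  :ι : ∀ {k} → ℕ → Polynomial k
  :ι zero    = con (+ 0)
  :ι (suc n) = con (+ 1) :+ :ι n

  ≤-reflexive : ∀ {x y} → x ≈ y → x ≤ y
  ≤-reflexive x≈y y<x = <.irrefl (sym x≈y) y<x

  ≤-refl : ∀ {x} → x ≤ x
  ≤-refl = ≤-reflexive refl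

  <⇒≤ : ∀ {x y} → x < y → x ≤ y
  <⇒≤ x<y y<x = <.asym x<y y<x

  ≤-trans : ∀ {x y z} → x ≤ y → y ≤ z → x ≤ z
  ≤-trans x≤y y≤z z<x = y≤z (<-≤-trans z<x x≤y)

  -- Apartness would yield one of the two strict inequalities, both excluded; tightness turns its
  -- absence into equality.
  ≤-antisym : ∀ {x y} → x ≤ y → y ≤ x → x ≈ y
  ≤-antisym {x} {y} x≤y y≤x = proj₁ (tight x y) ¬x#y
    where
    ¬x#y : ¬ (x # y)
    ¬x#y x#y = [ y≤x , x≤y ]′ (#⇒<⊎> x#y)

  ≤-respˡ : ∀ {x y z} → x ≈ y → x ≤ z → y ≤ z
  ≤-respˡ x≈y = ≤-trans (≤-reflexive (sym x≈y))

  ≤-respʳ : ∀ {x y z} → x ≈ y → z ≤ x → z ≤ y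
  ≤-respʳ x≈y z≤x = ≤-trans z≤x (≤-reflexive x≈y)

  0<y-x : ∀ {x y} → x < y → 0# < y - x
  0<y-x {x} x<y = <.<-respˡ-≈ (-‿inverseʳ x) (+-monoˡ-< (- x) x<y)

  -- Inequalities are proved from a decomposition e of y - x into positive
  -- (nonnegative) terms, which the ring solver checks.
  <-by : ∀ {x y e} → 0# < e → e ≈ y - x → x < y
  <-by {x} {y} {e} 0<e e≈y-x =
    <.<-respˡ-≈ (+-identityˡ x) (<.<-respʳ-≈ e+x≈y (+-monoˡ-< x 0<e))
    where
    e+x≈y = trans (+-congʳ e≈y-x)
      (solve 2 (λ x y → (y :- x) :+ x := y) refl x y)

  0≤y-x : ∀ {x y} → x ≤ y → 0# ≤ y - x
  0≤y-x {x} {y} x≤y y-x<0 = x≤y (<-by (0<y-x y-x<0)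
    (solve 2 (λ x y → con (+ 0) :- (y :- x) := x :- y) refl x y))

  ≤-by : ∀ {x y e} → 0# ≤ e → e ≈ y - x → x ≤ y
  ≤-by {x} {y} 0≤e e≈y-x y<x = 0≤e (<.<-respˡ-≈ (sym e≈y-x)
    (<-by (0<y-x y<x) (solve 2 (λ x y → x :- y := con (+ 0) :- (y :- x)) refl x y)))

  ≈⇒0≤y-x : ∀ {x y} → x ≈ y → 0# ≤ y - x
  ≈⇒0≤y-x x≈y = 0≤y-x (≤-reflexive x≈y)

  +-nonneg : ∀ {x y} → 0# ≤ x → 0# ≤ y → 0# ≤ x + y
  +-nonneg {x} {y} 0≤x 0≤y = ≤-trans 0≤x (≤-by 0≤y
    (solve 2 (λ x y → y := (x :+ y) :- x) refl x y))

  +-pos-nonneg : ∀ {x y} → 0# < x → 0# ≤ y → 0# < x + y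
  +-pos-nonneg {x} {y} 0<x 0≤y = <-≤-trans 0<x (≤-by 0≤y
    (solve 2 (λ x y → y := (x :+ y) :- x) refl x y))

  +-pos : ∀ {x y} → 0# < x → 0# < y → 0# < x + y
  +-pos 0<x 0<y = +-pos-nonneg 0<x (<⇒≤ 0<y)

  -- The goal is a negation, so both factors may be assumed positive: a nonnegative factor that is
  -- not positive equals `0#` and makes the product vanish.
  *-nonneg : ∀ {x y} → 0# ≤ x → 0# ≤ y → 0# ≤ x * y
  *-nonneg {x} {y} 0≤x 0≤y xy<0 = ¬¬0<x λ 0<x → ¬¬0<y λ 0<y →
    <.asym xy<0 (*-pos 0<x 0<y)
    where
    ¬¬0<x : ¬ ¬ (0# < x)
    ¬¬0<x x≤0 = <.irrefl (trans (*-congʳ (sym (≤-antisym 0≤x x≤0))) (zeroˡ y)) xy<0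
    ¬¬0<y : ¬ ¬ (0# < y)
    ¬¬0<y y≤0 = <.irrefl (trans (*-congˡ (sym (≤-antisym 0≤y y≤0))) (zeroʳ x)) xy<0

  0≤1 : 0# ≤ 1#
  0≤1 = <⇒≤ 0<1

  *-cancelʳ-≤ : ∀ {x y z} → 0# < z → x * z ≤ y * z → x ≤ y
  *-cancelʳ-≤ {x} {y} {z} 0<z xz≤yz y<x = xz≤yz (<-by (*-pos (0<y-x y<x) 0<z)
    (solve 3 (λ x y z → (x :- y) :* z := x :* z :- y :* z) refl x y z))

  *-cancelʳ-≈ : ∀ {x y z} → 0# < z → x * z ≈ y * z → x ≈ y
  *-cancelʳ-≈ 0<z xz≈yz = ≤-antisym
    (*-cancelʳ-≤ 0<z (≤-reflexive xz≈yz))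
    (*-cancelʳ-≤ 0<z (≤-reflexive (sym xz≈yz)))

  ≤-<-trans : ∀ {x y z} → x ≤ y → y < z → x < z
  ≤-<-trans {x} {y} {z} x≤y y<z = <-by (+-pos-nonneg (0<y-x y<z) (0≤y-x x≤y))
    (solve 3 (λ x y z → (z :- y) :+ (y :- x) := z :- x) refl x y z)

  -- z / (y z - x z) inverts y - x, which decides the apartness of x and y.
  *-cancelʳ-< : ∀ {x y z} → 0# < z → x * z < y * z → x < y
  *-cancelʳ-< {x} {y} {z} 0<z xz<yz =
    [ (λ y<x → ⊥-elim (*-cancelʳ-≤ 0<z (<⇒≤ xz<yz) y<x)) , id ]′ (#⇒<⊎> y#x)
    where
    difference = #⇒invertible (#-sym (<⇒# (0<y-x xz<yz)))
    inverse    = proj₁ difference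
    isInverse : z * inverse * (y - x) ≈ 1#
    isInverse = trans
      (solve 4 (λ x y z i → z :* i :* (y :- x)
        := i :* ((y :* z :- x :* z) :- con (+ 0))) refl x y z inverse)
      (proj₁ (proj₂ difference))
    y#x : y # x
    y#x = invertible⇒# (z * inverse , isInverse , trans (*-comm _ _) isInverse)

  -- If `y < x`, then `x` is positive and so is `(x - y)(x + y)`, the difference of the squares.
  square-cancel-≤ : ∀ {x y} → 0# ≤ y → x * x ≤ y * y → x ≤ y
  square-cancel-≤ {x} {y} 0≤y xx≤yy y<x = xx≤yy
    (<-by (*-pos (0<y-x y<x) (+-pos-nonneg (≤-<-trans 0≤y y<x) 0≤y))
      (solve 2 (λ x y → (x :- y) :* (x :+ y) := x :* x :- y :* y) refl x y))

  /-cancel : ∀ {x y} (0<y : 0# < y) → x / y ⟨ 0<y ⟩ * y ≈ x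
  /-cancel {x} {y} 0<y = begin
    x * y⁻¹ * y         ≈⟨ solve 3 (λ x y i → x :* i :* y
                             := x :* (i :* (y :- con (+ 0)))) refl x y y⁻¹ ⟩
    x * (y⁻¹ * (y - 0#)) ≈⟨ *-congˡ (proj₁ (proj₂ y-invertible)) ⟩
    x * 1#              ≈⟨ *-identityʳ x ⟩
    x                   ∎
    where
    y-invertible = #⇒invertible (#-sym (<⇒# 0<y))
    y⁻¹ = proj₁ y-invertible

  /-unique : ∀ {x y q} (0<y : 0# < y) → q * y ≈ x → q ≈ x / y ⟨ 0<y ⟩
  /-unique 0<y qy≈x = *-cancelʳ-≈ 0<y (trans qy≈x (sym (/-cancel 0<y)))

  /-mono-≤ : ∀ {x x′ y} (0<y : 0# < y) → x ≤ x′ → x / y ⟨ 0<y ⟩ ≤ x′ / y ⟨ 0<y ⟩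
  /-mono-≤ 0<y x≤x′ = *-cancelʳ-≤ 0<y
    (≤-respˡ (sym (/-cancel 0<y)) (≤-respʳ (sym (/-cancel 0<y)) x≤x′))

  /-pos : ∀ {x y} (0<y : 0# < y) → 0# < x → 0# < x / y ⟨ 0<y ⟩
  /-pos 0<y 0<x = *-cancelʳ-< 0<y
    (<.<-respˡ-≈ (sym (zeroˡ _)) (<.<-respʳ-≈ (sym (/-cancel 0<y)) 0<x))

  1≤/ : ∀ {x y} (0<y : 0# < y) → y ≤ x → 1# ≤ x / y ⟨ 0<y ⟩
  1≤/ 0<y y≤x = *-cancelʳ-≤ 0<y
    (≤-respˡ (sym (*-identityˡ _)) (≤-respʳ (sym (/-cancel 0<y)) y≤x))

  0≤ι : ∀ n → 0# ≤ ι n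
  0≤ι zero    = ≤-refl
  0≤ι (suc n) = <⇒≤ (0<ι n)

  1≤ι : ∀ n → 1# ≤ ι (suc n)
  1≤ι n = ≤-by (0≤ι n) (solve 1 (λ k → k := (con (+ 1) :+ k) :- con (+ 1)) refl (ι n))

  ι-mono-≤ : ∀ {m n} → m ℕ.≤ n → ι m ≤ ι n
  ι-mono-≤ {n = n} ℕ.z≤n = 0≤ι n
  ι-mono-≤ {suc m} {suc n} (ℕ.s≤s m≤n) = ≤-by (0≤y-x (ι-mono-≤ m≤n))
    (solve 2 (λ i j → j :- i := (con (+ 1) :+ j) :- (con (+ 1) :+ i)) refl (ι m) (ι n))

-- Existence of square roots by Newton's iteration.

module SquareRoot {c ℓ₁ ℓ₂} (ℝ : Reals c ℓ₁ ℓ₂) where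
  open Reals ℝ
  open OrderedFieldProperties orderedField
  private module < = IsStrictPartialOrder isStrictPartialOrder

  module Newton (a : Carrier) (1≤a : 1# ≤ a) where

    -- The invariant of the iteration: positivity permits the next division, and the second bound
    -- keeps the values on or above the root.
    record Iterate : Set (c ⊔ ℓ₂) where
      field
        value    : Carrier
        0<value  : 0# < value
        a≤value² : a ≤ value * value

      excess : Carrier
      excess = value * value - a

      0≤excess : 0# ≤ excess
      0≤excess = 0≤y-x a≤value²

      1≤value : 1# ≤ value
      1≤value = square-cancel-≤ (<⇒≤ 0<value)
        (≤-respˡ (sym (*-identityˡ 1#)) (≤-trans 1≤a a≤value²))

    open Iterate

    0<a : 0# < a
    0<a = <-≤-trans 0<1 1≤a

    module Step (i : Iterate) where
      x  = value i
      e  = excess i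
      0<2x = +-pos (0<value i) (0<value i)
      x′ = (x * x + a) / (x + x) ⟨ 0<2x ⟩
      4x² = (x + x) * (x + x)
      0<4x² = *-pos 0<2x 0<2x

      -- With denominators cleared this is `(x² + a)² - 4ax² = (x² - a)²`. The new excess is thus a
      -- square over `4x²`, hence nonnegative.
      newton : (x′ * x′ - a) * 4x² ≈ e * e
      newton = begin
        (x′ * x′ - a) * 4x²
          ≈⟨ solve 3 (λ x x′ a → (x′ :* x′ :- a) :* ((x :+ x) :* (x :+ x))
               := (x′ :* (x :+ x)) :* (x′ :* (x :+ x)) :- a :* ((x :+ x) :* (x :+ x)))
               refl x x′ a ⟩
        (x′ * (x + x)) * (x′ * (x + x)) - a * 4x²
          ≈⟨ +-congʳ (*-cong (/-cancel 0<2x) (/-cancel 0<2x)) ⟩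
        (x * x + a) * (x * x + a) - a * 4x²
          ≈⟨ solve 2 (λ x a → (x :* x :+ a) :* (x :* x :+ a) :- a :* ((x :+ x) :* (x :+ x))
               := (x :* x :- a) :* (x :* x :- a)) refl x a ⟩
        e * e ∎
        where open SetoidReasoning setoid

      next : Iterate
      next = record
        { value    = x′
        ; 0<value  = /-pos 0<2x (+-pos (*-pos (0<value i) (0<value i)) 0<a)
        ; a≤value² = ≤-by (*-cancelʳ-≤ 0<4x² (≤-respˡ (sym (zeroˡ 4x²)) (≤-respʳ (sym newton)
                       (*-nonneg (0≤excess i) (0≤excess i))))) refl
        }

      -- After multiplication by `4x²` the slack is `4x²e - 2e² = 2e(x² + a)`, a product of
      -- nonnegative factors.
      halving : excess next + excess next ≤ e
      halving = *-cancelʳ-≤ 0<4x² (≤-by 0≤2e[x²+a] (begin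
        e * ((x * x + a) + (x * x + a))
          ≈⟨ solve 2 (λ x a → (x :* x :- a) :* ((x :* x :+ a) :+ (x :* x :+ a))
               := (x :* x :- a) :* ((x :+ x) :* (x :+ x))
                  :- ((x :* x :- a) :* (x :* x :- a) :+ (x :* x :- a) :* (x :* x :- a)))
               refl x a ⟩
        e * 4x² - (e * e + e * e)
          ≈⟨ +-congˡ (-‿cong (+-cong newton newton)) ⟨
        e * 4x² - (excess next * 4x² + excess next * 4x²)
          ≈⟨ +-congˡ (-‿cong (distribʳ 4x² _ _)) ⟨
        e * 4x² - (excess next + excess next) * 4x² ∎))
        where
        open SetoidReasoning setoid
        0≤x²+a : 0# ≤ x * x + a
        0≤x²+a = <⇒≤ (+-pos (*-pos (0<value i) (0<value i)) 0<a)
        0≤2e[x²+a] : 0# ≤ e * ((x * x + a) + (x * x + a))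
        0≤2e[x²+a] = *-nonneg (0≤excess i) (+-nonneg 0≤x²+a 0≤x²+a)

    iterate : ℕ → Iterate
    -- The start `a` is above its root because `a² - a = a(a - 1)` and `a` is at least 1.
    iterate zero    = record
      { value    = a
      ; 0<value  = 0<a
      ; a≤value² = ≤-by (*-nonneg (<⇒≤ 0<a) (0≤y-x 1≤a))
          (solve 1 (λ a → a :* (a :- con (+ 1)) := a :* a :- a) refl a)
      }
    iterate (suc n) = Step.next (iterate n)

    x : ℕ → Carrier
    x n = value (iterate n)

    e : ℕ → Carrier
    e n = excess (iterate n)

    -- For `k ≥ 1` halving gives `e′(k + 1) ≤ 2e′k ≤ ek`. This harmonic rate meets the Archimedean
    -- property directly, without powers of two.
    excess-decay : ∀ n → e n * ι (suc n) ≤ e 0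
    excess-decay zero = ≤-reflexive
      (solve 1 (λ e → e :* :ι 1 := e) refl (e 0))
    excess-decay (suc n) = ≤-by
      (+-nonneg (0≤y-x (excess-decay n))
        (+-nonneg (*-nonneg (0≤y-x (Step.halving (iterate n))) (0≤ι (suc n)))
                  (*-nonneg (0≤excess (iterate (suc n))) (0≤y-x (1≤ι n)))))
      (solve 4 (λ e₀ e e′ k →
          (e₀ :- e :* k) :+ ((e :- (e′ :+ e′)) :* k :+ e′ :* (k :- con (+ 1)))
          := e₀ :- e′ :* (con (+ 1) :+ k))
        refl (e 0) (e n) (e (suc n)) (ι (suc n)))

    -- Once `N` exceeds `e 0 / ε`, the decay bound gives `e n (n + 1) ≤ e 0 < εN ≤ ε(n + 1)`, and
    -- `n + 1` cancels.
    excess-small : ∀ ε → 0# < ε → ∃ λ N → ∀ n → N ℕ.≤ n → e n < ε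
    excess-small ε 0<ε with archimedean (e 0 / ε ⟨ 0<ε ⟩)
    ... | N , e₀/ε<N = N , λ n N≤n → *-cancelʳ-< (0<ι n) (≤-<-trans (excess-decay n)
      (<-by (+-pos-nonneg (*-pos 0<ε (0<y-x e₀/ε<N))
              (*-nonneg (<⇒≤ 0<ε) (0≤y-x (ι-mono-≤ (ℕ.m≤n⇒m≤1+n N≤n)))))
        (trans
          (solve 4 (λ ε q N n → ε :* (N :- q) :+ ε :* (n :- N) := ε :* n :- q :* ε)
            refl ε (e 0 / ε ⟨ 0<ε ⟩) (ι N) (ι (suc n)))
          (+-congˡ (-‿cong (/-cancel 0<ε))))))

  -- The limit of a sequence whose squares tend to `a` from above.

  module Limit {a : Carrier} {x : ℕ → Carrier}
    (1≤x : ∀ n → 1# ≤ x n) (a≤x² : ∀ n → a ≤ x n * x n)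
    (x²-a-small : ∀ ε → 0# < ε → ∃ λ N → ∀ n → N ℕ.≤ n → x n * x n - a < ε)
    where

    0<x : ∀ n → 0# < x n
    0<x n = <-≤-trans 0<1 (1≤x n)

    -- For terms `x`, `y` one has `(x - y)(x + y) = x² - y² ≤ x² - a < ε ≤ ε(x + y)`, since all
    -- terms are at least 1.
    x-cauchy : IsCauchy x
    x-cauchy ε 0<ε with x²-a-small ε 0<ε
    ... | N , small = N , λ m n N≤m _ →
      *-cancelʳ-< (+-pos (0<x m) (0<x n))
        (<-by (+-pos-nonneg (0<y-x (small m N≤m)) (+-nonneg (0≤y-x (a≤x² n))
                (*-nonneg (<⇒≤ 0<ε) (+-nonneg (0≤y-x (1≤x m)) (<⇒≤ (0<x n))))))
          (solve 4 (λ a ε x y →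
              (ε :- (x :* x :- a)) :+ ((y :* y :- a) :+ ε :* ((x :- con (+ 1)) :+ y))
              := (y :+ ε) :* (x :+ y) :- x :* (x :+ y))
            refl a ε (x m) (x n)))

    module _ {l : Carrier} (x⟶l : x ConvergesTo l) where

      0≤l : 0# ≤ l
      -- With tolerance `-l` some term would lie below `l - l`, that is, below zero.
      0≤l l<0 with x⟶l (0# - l) (0<y-x l<0)
      ... | N , near = <⇒≤ (0<x N) (<.<-respʳ-≈
        (solve 1 (λ l → l :+ (con (+ 0) :- l) := con (+ 0)) refl l) (proj₁ (near N ℕ.≤-refl)))

      -- One index serves three tolerances; the bound by `l + 1` keeps `x n + l` below `2l + 1` in
      -- the estimates of `x n * x n - l * l`.
      near : ∀ ε → 0# < ε → ∃ λ n →
        x n < l + 1# × x n < l + ε × l < x n + ε × x n * x n - a < ε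
      near ε 0<ε with x⟶l 1# 0<1 | x⟶l ε 0<ε | x²-a-small ε 0<ε
      ... | N₁ , near₁ | N₂ , near₂ | N₃ , small =
        n , proj₁ (near₁ n (ℕ.m≤m⊔n N₁ _)) , proj₁ l-near , proj₂ l-near ,
        small n (ℕ.≤-trans (ℕ.m≤n⊔m N₂ N₃) (ℕ.m≤n⊔m N₁ _))
        where
        n = N₁ ℕ.⊔ (N₂ ℕ.⊔ N₃)
        l-near = near₂ n (ℕ.≤-trans (ℕ.m≤m⊔n N₂ N₃) (ℕ.m≤n⊔m N₁ _))

      0<2l+2 : 0# < l + 1# + (l + 1#)
      0<2l+2 = +-pos 0<l+1 0<l+1
        where
        0<l+1 : 0# < l + 1#
        0<l+1 = <.<-respʳ-≈ (+-comm 1# l) (+-pos-nonneg 0<1 0≤l)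

      -- A gap δ between a and l² is contradicted by an iterate y within
      -- ε = δ / (2l + 2) of l, since then ∣ y² - l² ∣ < ε (2l + 1).
      module _ {ε y} (0<ε : 0# < ε) (0<y : 0# < y) (y<l+1 : y < l + 1#) where

        above-a : y < l + ε → ε * (l + 1# + (l + 1#)) ≈ a - l * l → y * y < a
        above-a y<l+ε ε-split = <-by 0<gap (begin
          ε + ((l + ε - y) * (y + l) + ε * (l + 1# - y))
            ≈⟨ solve 3 (λ ε y l →
                 ε :+ ((l :+ ε :- y) :* (y :+ l) :+ ε :* (l :+ con (+ 1) :- y))
                 := ε :* (l :+ con (+ 1) :+ (l :+ con (+ 1))) :- (y :* y :- l :* l))
               refl ε y l ⟩
          ε * (l + 1# + (l + 1#)) - (y * y - l * l)
            ≈⟨ +-congʳ ε-split ⟩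
          (a - l * l) - (y * y - l * l)
            ≈⟨ solve 3 (λ a y l → (a :- l :* l) :- (y :* y :- l :* l) := a :- y :* y)
                 refl a y l ⟩
          a - y * y ∎)
          where
          open SetoidReasoning setoid
          0<gap : 0# < ε + ((l + ε - y) * (y + l) + ε * (l + 1# - y))
          0<gap = +-pos-nonneg 0<ε (+-nonneg
            (*-nonneg (0≤y-x (<⇒≤ y<l+ε)) (+-nonneg (<⇒≤ 0<y) 0≤l))
            (*-nonneg (<⇒≤ 0<ε) (0≤y-x (<⇒≤ y<l+1))))

        below-a : l < y + ε → y * y - a < ε →
          ε * (l + 1# + (l + 1#)) ≈ l * l - a → ⊥
        below-a l<y+ε y²-a<ε ε-split = <.irrefl refl (<-by 0<gap (begin
          (ε - (y * y - a)) + ((y + ε - l) * (y + l) + ε * (l + 1# - y))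
            ≈⟨ solve 4 (λ a ε y l →
                 (ε :- (y :* y :- a)) :+
                   ((y :+ ε :- l) :* (y :+ l) :+ ε :* (l :+ con (+ 1) :- y))
                 := ε :* (l :+ con (+ 1) :+ (l :+ con (+ 1))) :- (l :* l :- a))
               refl a ε y l ⟩
          ε * (l + 1# + (l + 1#)) - (l * l - a)
            ≈⟨ +-congʳ ε-split ⟩
          (l * l - a) - (l * l - a) ∎))
          where
          open SetoidReasoning setoid
          0<gap : 0# < (ε - (y * y - a)) + ((y + ε - l) * (y + l) + ε * (l + 1# - y))
          0<gap = +-pos-nonneg (0<y-x y²-a<ε) (+-nonneg
            (*-nonneg (0≤y-x (<⇒≤ l<y+ε)) (+-nonneg (<⇒≤ 0<y) 0≤l))
            (*-nonneg (<⇒≤ 0<ε) (0≤y-x (<⇒≤ y<l+1))))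

      a≤l² : a ≤ l * l
      a≤l² l²<a =
        let 0<ε = /-pos 0<2l+2 (0<y-x l²<a)
            n , x<l+1 , x<l+ε , _ = near _ 0<ε
        in a≤x² n (above-a 0<ε (0<x n) x<l+1 x<l+ε (/-cancel 0<2l+2))

      l²≤a : l * l ≤ a
      l²≤a a<l² =
        let 0<ε = /-pos 0<2l+2 (0<y-x a<l²)
            n , x<l+1 , _ , l<x+ε , x²-a<ε = near _ 0<ε
        in below-a 0<ε (0<x n) x<l+1 l<x+ε x²-a<ε (/-cancel 0<2l+2)

    √a : ∃ (IsSqrt a)
    √a = let l , x⟶l = complete x x-cauchy
         in l , 0≤l x⟶l , ≤-antisym (l²≤a x⟶l) (a≤l² x⟶l)

  ∃√ : ∀ {a} → 1# ≤ a → ∃ (IsSqrt a)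
  ∃√ {a} 1≤a = Limit.√a
    (λ n → Iterate.1≤value (iterate n)) (λ n → Iterate.a≤value² (iterate n)) excess-small
    where open Newton a 1≤a

-- Inequalities for the ratios `w` and `v`, and the extremal first pair.

module Components {c ℓ₁ ℓ₂} (F : OrderedField c ℓ₁ ℓ₂) where
  open OrderedField F
  open OrderedFieldProperties F
  open SetoidReasoning setoid

  module _ {w v r} (1≤w : 1# ≤ w) (1≤v : 1# ≤ v) (wv≈r : w * v ≈ r) where

    w+v≤r+1 : w + v ≤ r + 1#
    w+v≤r+1 = ≤-by (*-nonneg (0≤y-x 1≤w) (0≤y-x 1≤v)) (begin
      (w - 1#) * (v - 1#)
        ≈⟨ solve 2 (λ w v → (w :- con (+ 1)) :* (v :- con (+ 1))
             := (w :* v :+ con (+ 1)) :- (w :+ v)) refl w v ⟩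
      (w * v + 1#) - (w + v)  ≈⟨ +-congʳ (+-congʳ wv≈r) ⟩
      (r + 1#) - (w + v)      ∎)

    -- The slack is `(w - 1)(v + 1)`.
    v-w≤r-1 : v - w ≤ r - 1#
    v-w≤r-1 = ≤-by (*-nonneg (0≤y-x 1≤w) (+-nonneg (≤-trans 0≤1 1≤v) 0≤1)) (begin
      (w - 1#) * (v + 1#)
        ≈⟨ solve 2 (λ w v → (w :- con (+ 1)) :* (v :+ con (+ 1))
             := (w :* v :- con (+ 1)) :- (v :- w)) refl w v ⟩
      (w * v - 1#) - (v - w)  ≈⟨ +-congʳ (+-congʳ wv≈r) ⟩
      (r - 1#) - (v - w)      ∎)

    w-v≤r-1 : w - v ≤ r - 1#
    w-v≤r-1 = ≤-by (*-nonneg (0≤y-x 1≤v) (+-nonneg (≤-trans 0≤1 1≤w) 0≤1)) (begin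
      (v - 1#) * (w + 1#)
        ≈⟨ solve 2 (λ w v → (v :- con (+ 1)) :* (w :+ con (+ 1))
             := (w :* v :- con (+ 1)) :- (w :- v)) refl w v ⟩
      (w * v - 1#) - (w - v)  ≈⟨ +-congʳ (+-congʳ wv≈r) ⟩
      (r - 1#) - (w - v)      ∎)

  -- (w + v)² = 4 w v + (w - v)²
  w+v≤√ : ∀ {w v r D s} → w * v ≈ r → IsSqrt (ι 4 * r + D * D) s →
    w - v ≤ D → v - w ≤ D → w + v ≤ s
  w+v≤√ {w} {v} {r} {D} {s} wv≈r (0≤s , s²≈) w-v≤D v-w≤D =
    square-cancel-≤ 0≤s (≤-by (*-nonneg (0≤y-x w-v≤D) (0≤y-x v-w≤D)) (begin
      (D - (w - v)) * (D - (v - w))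
        ≈⟨ solve 3 (λ w v D → (D :- (w :- v)) :* (D :- (v :- w))
             := (:ι 4 :* (w :* v) :+ D :* D) :- (w :+ v) :* (w :+ v)) refl w v D ⟩
      (ι 4 * (w * v) + D * D) - (w + v) * (w + v)
        ≈⟨ +-congʳ (+-congʳ (*-congˡ wv≈r)) ⟩
      (ι 4 * r + D * D) - (w + v) * (w + v)  ≈⟨ +-congʳ s²≈ ⟨
      s * s - (w + v) * (w + v) ∎))

  -- Used as it stands and with `w` and `v` exchanged, this bounds the absolute value of `w₁ - v₁`.
  -- The trailing `0#` comes from unfolding `sum`.
  balance-≤ : ∀ {w₁ v₁ w₂ v₂ w₃ v₃ w₄ v₄ b₂ b₃ b₄} →
    w₁ + (w₂ + (w₃ + (w₄ + 0#))) ≈ v₁ + (v₂ + (v₃ + (v₄ + 0#))) →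
    v₂ - w₂ ≤ b₂ → v₃ - w₃ ≤ b₃ → v₄ - w₄ ≤ b₄ → w₁ - v₁ ≤ b₂ + b₃ + b₄
  balance-≤ {w₁} {v₁} {w₂} {v₂} {w₃} {v₃} {w₄} {v₄} {b₂} {b₃} {b₄} W≈V ≤b₂ ≤b₃ ≤b₄ = ≤-by
    (+-nonneg (+-nonneg (+-nonneg (≈⇒0≤y-x W≈V) (0≤y-x ≤b₂)) (0≤y-x ≤b₃)) (0≤y-x ≤b₄))
    (solve 11 (λ w₁ v₁ w₂ v₂ w₃ v₃ w₄ v₄ b₂ b₃ b₄ →
      let W = w₁ :+ (w₂ :+ (w₃ :+ (w₄ :+ con (+ 0))))
          V = v₁ :+ (v₂ :+ (v₃ :+ (v₄ :+ con (+ 0))))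
      in
      (V :- W) :+ (b₂ :- (v₂ :- w₂)) :+ (b₃ :- (v₃ :- w₃)) :+ (b₄ :- (v₄ :- w₄))
      := (b₂ :+ b₃ :+ b₄) :- (w₁ :- v₁))
      refl w₁ v₁ w₂ v₂ w₃ v₃ w₄ v₄ b₂ b₃ b₄)

  -- By the balance, `V + V = W + V`, which regroups into the four sums `w + v`.
  sum-≤ : ∀ {w₁ v₁ w₂ v₂ w₃ v₃ w₄ v₄ b₁ b₂ b₃ b₄} →
    w₁ + (w₂ + (w₃ + (w₄ + 0#))) ≈ v₁ + (v₂ + (v₃ + (v₄ + 0#))) →
    w₁ + v₁ ≤ b₁ → w₂ + v₂ ≤ b₂ → w₃ + v₃ ≤ b₃ → w₄ + v₄ ≤ b₄ →
    let V = v₁ + (v₂ + (v₃ + (v₄ + 0#))) in V + V ≤ b₁ + b₂ + b₃ + b₄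
  sum-≤ {w₁} {v₁} {w₂} {v₂} {w₃} {v₃} {w₄} {v₄} {b₁} {b₂} {b₃} {b₄} W≈V ≤b₁ ≤b₂ ≤b₃ ≤b₄ = ≤-by
    (+-nonneg (+-nonneg (+-nonneg (+-nonneg (≈⇒0≤y-x (sym W≈V)) (0≤y-x ≤b₁))
      (0≤y-x ≤b₂)) (0≤y-x ≤b₃)) (0≤y-x ≤b₄))
    (solve 12 (λ w₁ v₁ w₂ v₂ w₃ v₃ w₄ v₄ b₁ b₂ b₃ b₄ →
      let W = w₁ :+ (w₂ :+ (w₃ :+ (w₄ :+ con (+ 0))))
          V = v₁ :+ (v₂ :+ (v₃ :+ (v₄ :+ con (+ 0))))
      in
      (W :- V) :+ (b₁ :- (w₁ :+ v₁)) :+ (b₂ :- (w₂ :+ v₂))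
        :+ (b₃ :- (w₃ :+ v₃)) :+ (b₄ :- (w₄ :+ v₄))
      := (b₁ :+ b₂ :+ b₃ :+ b₄) :- (V :+ V))
      refl w₁ v₁ w₂ v₂ w₃ v₃ w₄ v₄ b₁ b₂ b₃ b₄)

  module Maximiser {D r s} (0≤D : 0# ≤ D) (D≤r-1 : D ≤ r - 1#)
    (√ : IsSqrt (ι 4 * r + D * D) s) where

    -- The solution of `w - v = D` and `w + v = s`; then `4wv = s² - D² = 4r`.
    v w : Carrier
    v = (s - D) /ℕ 2
    w = v + D

    v*2≈s-D : v * ι 2 ≈ s - D
    v*2≈s-D = /-cancel (0<ι 1)

    -- Since `D + 1 ≤ r`, `(D + 2)² = D² + 4(D + 1) ≤ D² + 4r = s²`. This is what makes `v` at least
    -- 1.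
    D+2≤s : D + ι 2 ≤ s
    D+2≤s = square-cancel-≤ (proj₁ √) (≤-by (+-nonneg 2*gap 2*gap) (begin
      ((r - 1# - D) + (r - 1# - D)) + ((r - 1# - D) + (r - 1# - D))
        ≈⟨ solve 2 (λ r D →
             let gap = r :- con (+ 1) :- D
             in (gap :+ gap) :+ (gap :+ gap)
                := (:ι 4 :* r :+ D :* D) :- (D :+ :ι 2) :* (D :+ :ι 2)) refl r D ⟩
      (ι 4 * r + D * D) - (D + ι 2) * (D + ι 2)  ≈⟨ +-congʳ (proj₂ √) ⟨
      s * s - (D + ι 2) * (D + ι 2)              ∎))
      where
      2*gap : 0# ≤ (r - 1# - D) + (r - 1# - D)
      2*gap = +-nonneg (0≤y-x D≤r-1) (0≤y-x D≤r-1)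

    1≤v : 1# ≤ v
    1≤v = *-cancelʳ-≤ (0<ι 1) (≤-respʳ (sym v*2≈s-D) (≤-by (0≤y-x D+2≤s)
      (solve 2 (λ s D → s :- (D :+ :ι 2) := (s :- D) :- con (+ 1) :* :ι 2) refl s D)))

    1≤w : 1# ≤ w
    1≤w = ≤-trans 1≤v (≤-by 0≤D (solve 2 (λ v D → D := (v :+ D) :- v) refl v D))

    wv≈r : w * v ≈ r
    wv≈r = *-cancelʳ-≈ (0<ι 3) (begin
      (v + D) * v * ι 4
        ≈⟨ solve 2 (λ v D → (v :+ D) :* v :* :ι 4
             := (v :* :ι 2) :* (v :* :ι 2 :+ D :+ D)) refl v D ⟩
      (v * ι 2) * (v * ι 2 + D + D)
        ≈⟨ *-cong v*2≈s-D (+-congʳ (+-congʳ v*2≈s-D)) ⟩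
      (s - D) * (s - D + D + D)
        ≈⟨ solve 2 (λ s D → (s :- D) :* (s :- D :+ D :+ D) := s :* s :- D :* D) refl s D ⟩
      s * s - D * D
        ≈⟨ +-congʳ (proj₂ √) ⟩
      (ι 4 * r + D * D) - D * D
        ≈⟨ solve 3 (λ k r D → (k :* r :+ D :* D) :- D :* D := r :* k) refl (ι 4) r D ⟩
      r * ι 4 ∎)

    2v≈s-D : v + v ≈ s - D
    2v≈s-D = trans (solve 1 (λ v → v :+ v := v :* :ι 2) refl v) v*2≈s-D

-- The upper bound over `𝒮` and a point attaining it.

module FourObjectives {c ℓ₁ ℓ₂} (ℝ : Reals c ℓ₁ ℓ₂) (I : PriceIntervals ℝ 4) where
  open Reals ℝ hiding (_#_; zero)
  open PriceIntervals I
  open OrderedFieldProperties orderedField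
  open Components orderedField
  open SetoidReasoning setoid

  r₁ = fluctuationRatio (# 0)
  r₂ = fluctuationRatio (# 1)
  r₃ = fluctuationRatio (# 2)
  r₄ = fluctuationRatio (# 3)

  D : Carrier
  D = (r₂ - 1#) + (r₃ - 1#) + (r₄ - 1#)

  -- Both the bound and the attained value are computed for twice the sum of the `v i`, which turns
  -- the mean into eighths.
  /ℕ4≈double/ℕ8 : ∀ x → x /ℕ 4 ≈ (x + x) /ℕ 8
  /ℕ4≈double/ℕ8 x = /-unique (0<ι 7) (begin
    (x /ℕ 4) * ι 8
      ≈⟨ solve 1 (λ q → q :* :ι 8 := q :* :ι 4 :+ q :* :ι 4) refl (x /ℕ 4) ⟩
    (x /ℕ 4) * ι 4 + (x /ℕ 4) * ι 4  ≈⟨ +-cong (/-cancel (0<ι 3)) (/-cancel (0<ι 3)) ⟩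
    x + x                            ∎)

  module _ {x : Vector Carrier 4} (x∈ : InBox x) where

    w v : Vector Carrier 4
    w i = x i / m i ⟨ 0<m i ⟩
    v i = M i / x i ⟨ InBox⇒0< x∈ i ⟩

    1≤w : ∀ i → 1# ≤ w i
    1≤w i = 1≤/ (0<m i) (proj₁ (x∈ i))

    1≤v : ∀ i → 1# ≤ v i
    1≤v i = 1≤/ (InBox⇒0< x∈ i) (proj₂ (x∈ i))

    wv≈r : ∀ i → w i * v i ≈ fluctuationRatio i
    wv≈r i = /-unique (0<m i) (begin
      w i * v i * m i    ≈⟨ solve 3 (λ w v m → w :* v :* m := v :* (w :* m)) refl (w i) (v i) (m i) ⟩
      v i * (w i * m i)  ≈⟨ *-congˡ (/-cancel (0<m i)) ⟩
      v i * x i          ≈⟨ /-cancel (InBox⇒0< x∈ i) ⟩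
      M i                ∎)

    mean-≤ : ∀ {s} → IsSqrt (ι 4 * r₁ + D * D) s → 𝒮 (x , x∈) →
      meanOfMaxOverPrice x x∈ ≤ (s + (r₂ + 1#) + (r₃ + 1#) + (r₄ + 1#)) /ℕ 8
    mean-≤ √ means≈ = ≤-respˡ (sym (/ℕ4≈double/ℕ8 (sum v))) (/-mono-≤ (0<ι 7)
      (sum-≤ W≈V
        (w+v≤√ (wv≈r (# 0)) √
          (balance-≤ W≈V (v-w≤ (# 1)) (v-w≤ (# 2)) (v-w≤ (# 3)))
          (balance-≤ (sym W≈V) (w-v≤ (# 1)) (w-v≤ (# 2)) (w-v≤ (# 3))))
        (w+v≤ (# 1)) (w+v≤ (# 2)) (w+v≤ (# 3))))
      where
      W≈V : sum w ≈ sum v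
      W≈V = trans (sym (/-cancel (0<ι 3))) (trans (*-congʳ means≈) (/-cancel (0<ι 3)))
      w+v≤ = λ i → w+v≤r+1 (1≤w i) (1≤v i) (wv≈r i)
      v-w≤ = λ i → v-w≤r-1 (1≤w i) (1≤v i) (wv≈r i)
      w-v≤ = λ i → w-v≤r-1 (1≤w i) (1≤v i) (wv≈r i)

  module _ {s} (0≤D : 0# ≤ D) (D≤r₁-1 : D ≤ r₁ - 1#)
    (√ : IsSqrt (ι 4 * r₁ + D * D) s) where

    private module Max = Maximiser 0≤D D≤r₁-1 √

    -- All prices but the first sit at their minimum, so there `w i` is 1 and `v i` is the whole
    -- fluctuation ratio.
    x̂ : Vector Carrier 4
    x̂ = (Max.w * m zero) ∷ tail m

    v*x̂₁≈M₁ : Max.v * x̂ zero ≈ M zero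
    v*x̂₁≈M₁ = begin
      Max.v * (Max.w * m zero)
        ≈⟨ solve 3 (λ v w m → v :* (w :* m) := w :* v :* m) refl Max.v Max.w (m zero) ⟩
      Max.w * Max.v * m zero  ≈⟨ *-congʳ Max.wv≈r ⟩
      r₁ * m zero             ≈⟨ /-cancel (0<m zero) ⟩
      M zero                  ∎

    ≤-scale : ∀ {x y z} → 1# ≤ x → 0# ≤ y → x * y ≈ z → y ≤ z
    ≤-scale {x} {y} 1≤x 0≤y xy≈z = ≤-respʳ xy≈z (≤-by (*-nonneg (0≤y-x 1≤x) 0≤y)
      (solve 2 (λ x y → (x :- con (+ 1)) :* y := x :* y :- y) refl x y))

    -- For the first price, `w ≥ 1` gives the lower bound, and `v ≥ 1` the upper one because `v`
    -- times that price is `M zero`.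
    x̂∈ : InBox x̂
    x̂∈ zero    = m≤x̂₁ , ≤-scale Max.1≤v (≤-trans (<⇒≤ (0<m zero)) m≤x̂₁) v*x̂₁≈M₁
      where m≤x̂₁ = ≤-scale Max.1≤w (<⇒≤ (0<m zero)) refl
    x̂∈ (suc i) = ≤-refl , m≤M (suc i)

    sum-ŵ : sum (w x̂∈) ≈ Max.w + ι 3
    sum-ŵ = +-cong (sym (/-unique (0<m zero) refl))
      (+-cong 1≈ (+-cong 1≈ (+-cong 1≈ refl)))
      where
      1≈ : ∀ {i} → m i / m i ⟨ 0<m i ⟩ ≈ 1#
      1≈ {i} = sym (/-unique (0<m i) (*-identityˡ _))

    sum-v̂ : sum (v x̂∈) ≈ Max.v + (r₂ + (r₃ + (r₄ + 0#)))
    sum-v̂ = +-cong (sym (/-unique _ v*x̂₁≈M₁))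
      (+-cong (r≈ (# 0)) (+-cong (r≈ (# 1)) (+-cong (r≈ (# 2)) refl)))
      where
      r≈ : ∀ i → v x̂∈ (suc i) ≈ fluctuationRatio (suc i)
      r≈ i = /-unique (0<m (suc i)) (/-cancel (InBox⇒0< x̂∈ (suc i)))

    -- The three units from the minimal prices cancel those subtracted in `D`.
    x̂∈𝒮 : 𝒮 (x̂ , x̂∈)
    x̂∈𝒮 = *-congʳ (begin
      sum (w x̂∈)                             ≈⟨ sum-ŵ ⟩
      Max.v + D + ι 3
        ≈⟨ solve 4 (λ v r₂ r₃ r₄ →
             v :+ ((r₂ :- con (+ 1)) :+ (r₃ :- con (+ 1)) :+ (r₄ :- con (+ 1))) :+ :ι 3
             := v :+ (r₂ :+ (r₃ :+ (r₄ :+ con (+ 0))))) refl Max.v r₂ r₃ r₄ ⟩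
      Max.v + (r₂ + (r₃ + (r₄ + 0#)))        ≈⟨ sum-v̂ ⟨
      sum (v x̂∈)                             ∎)

    -- As `2v = s - D`, each `2r` loses `r - 1` to `D` and leaves `r + 1`.
    mean-attained : (s + (r₂ + 1#) + (r₃ + 1#) + (r₄ + 1#)) /ℕ 8 ≈ meanOfMaxOverPrice x̂ x̂∈
    mean-attained = sym (trans (/ℕ4≈double/ℕ8 (sum (v x̂∈))) (*-congʳ (begin
      sum (v x̂∈) + sum (v x̂∈)  ≈⟨ +-cong sum-v̂ sum-v̂ ⟩
      R + R
        ≈⟨ solve 4 (λ v r₂ r₃ r₄ →
             let R = v :+ (r₂ :+ (r₃ :+ (r₄ :+ con (+ 0))))
             in R :+ R := (v :+ v) :+ ((r₂ :+ r₂) :+ (r₃ :+ r₃) :+ (r₄ :+ r₄)))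
             refl Max.v r₂ r₃ r₄ ⟩
      (Max.v + Max.v) + ((r₂ + r₂) + (r₃ + r₃) + (r₄ + r₄))
        ≈⟨ +-congʳ Max.2v≈s-D ⟩
      (s - D) + ((r₂ + r₂) + (r₃ + r₃) + (r₄ + r₄))
        ≈⟨ solve 4 (λ s r₂ r₃ r₄ →
             (s :- ((r₂ :- con (+ 1)) :+ (r₃ :- con (+ 1)) :+ (r₄ :- con (+ 1))))
               :+ ((r₂ :+ r₂) :+ (r₃ :+ r₃) :+ (r₄ :+ r₄))
             := s :+ (r₂ :+ con (+ 1)) :+ (r₃ :+ con (+ 1)) :+ (r₄ :+ con (+ 1)))
             refl s r₂ r₃ r₄ ⟩
      s + (r₂ + 1#) + (r₃ + 1#) + (r₄ + 1#) ∎)))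
      where R = Max.v + (r₂ + (r₃ + (r₄ + 0#)))

  -- This places the radicand in the range covered by `∃√`.
  1≤radicand : 1# ≤ r₁ → 0# ≤ D → 1# ≤ ι 4 * r₁ + D * D
  1≤radicand 1≤r₁ 0≤D = ≤-by
    (+-nonneg (+-nonneg (*-nonneg (0≤ι 4) (0≤y-x 1≤r₁)) (0≤ι 3)) (*-nonneg 0≤D 0≤D))
    (solve 2 (λ r D → :ι 4 :* (r :- con (+ 1)) :+ :ι 3 :+ D :* D
      := (:ι 4 :* r :+ D :* D) :- con (+ 1)) refl r₁ D)

theorem6p1 : ∀ {c ℓ₁ ℓ₂} (ℝ : Reals c ℓ₁ ℓ₂) (I : PriceIntervals ℝ 4) →
    let open Reals ℝ hiding (_#_)
        open PriceIntervals I
        r₁ = fluctuationRatio (# 0)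
        r₂ = fluctuationRatio (# 1)
        r₃ = fluctuationRatio (# 2)
        r₄ = fluctuationRatio (# 3)
        D  = (r₂ - 1#) + (r₃ - 1#) + (r₄ - 1#)
    in
    r₂ ≤ r₁ → r₃ ≤ r₂ → r₄ ≤ r₃ → 1# ≤ r₄ →
    D ≤ r₁ - 1# →
    ∃ λ s → IsSqrt (ι 4 * r₁ + D * D) s ×
      IsArithmeticMeanComponentCompetitiveRatio
        ((s + (r₂ + 1#) + (r₃ + 1#) + (r₄ + 1#)) /ℕ 8)
theorem6p1 ℝ I r₂≤r₁ r₃≤r₂ r₄≤r₃ 1≤r₄ D≤r₁-1 =
  let s , √ = ∃√ (1≤radicand (≤-trans 1≤r₂ r₂≤r₁) 0≤D)
  in s , √ ,
     (λ { y ((x , x∈) , x∈𝒮 , y≈mean) → ≤-respˡ (sym y≈mean) (mean-≤ x∈ √ x∈𝒮) }) ,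
     -- The supremum is a maximum: every upper bound dominates the value at `x̂`.
     (λ u isBound → isBound _
       ((x̂ 0≤D D≤r₁-1 √ , x̂∈ 0≤D D≤r₁-1 √) , x̂∈𝒮 0≤D D≤r₁-1 √ ,
        mean-attained 0≤D D≤r₁-1 √))
  where
  open Reals ℝ hiding (_#_)
  open OrderedFieldProperties orderedField
  open SquareRoot ℝ using (∃√)
  open FourObjectives ℝ I
  1≤r₃ = ≤-trans 1≤r₄ r₄≤r₃
  1≤r₂ = ≤-trans 1≤r₃ r₃≤r₂
  0≤D : 0# ≤ D
  0≤D = +-nonneg (+-nonneg (0≤y-x 1≤r₂) (0≤y-x 1≤r₃)) (0≤y-x 1≤r₄)
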